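{- For every integer $n\geq 1$, the game graph $G(\textsc{nim},*n)$ of single-heap Nim with starting heap of size $n$ has order $n+1$, size $\binom{n+1}{2}$, and metric dimension $\lceil \frac{n}{2}\rceil$.
   Context: Single-heap Nim: a position $*k$ is a heap of $k\ge 0$ stones ($*0$ is written $0$); a move removes any positive number of stones from the heap, i.e. goes from $*k$ to $*j$ for any $0\le j<k$. The game graph $G(\textsc{nim},*n)$ is the digraph whose vertices are all positions reachable from $*n$ (including $*n$ itself), with an arc from a position $p$ to a position $q$ whenever there is a legal move from $p$ to $q$ (each position appears as one vertex). The order of a graph is its number of vertices; its size is its number of arcs. Signed distance: in a digraph, let $d(u,v)$ be the number of arcs in a shortest directed path from $u$ to $v$ ($\infty$ if there is none, $d(u,u)=0$). The signed distance is $$d_{\pm}(u,v)=\begin{cases} d(u,v) & \text{if there is a directed } uv\text{ -path and } d(u,v)\le d(v,u),\\ -d(v,u) & \text{if there is a directed } vu\text{ -path and } d(v,u)<d(u,v),\\ \infty & \text{if there is neither a directed } uv\text{ -path nor a directed } vu\text{ -path.}\end{cases}$$ Metric dimension: for an ordered set $S=(u_1,\dots,u_k)$ of vertices, the distance vector of a vertex $v$ is $(d_\pm(u_1,v),\dots,d_\pm(u_k,v))$. $S$ is a resolving set if distinct vertices of the graph have distinct distance vectors. The metric dimension is the minimum cardinality of a resolving set. -}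

module Defs where

open import Data.Integer.Base using (ℤ; +_; -_)
open import Data.List.Base using (List; []; _∷_)
open import Data.List.Relation.Unary.Unique.Propositional using (Unique)
open import Data.Nat.Base using (ℕ; zero; suc; _≤_; _<_; _>_)
open import Data.Nat.Properties using (≤-antisym; <-≤-trans; <-irrefl)
open import Data.Fin.Base using (Fin)
open import Data.Product.Base using (Σ; ∃; _×_; _,_)
open import Data.Refinement.Base using (Refinement; value)
open import Data.Vec.Base using (Vec; map)
import Data.Vec.Relation.Unary.Unique.Propositional as Vec
open import Function.Bundles using (_↔_)
open import Relation.Binary.Construct.Add.Supremum.NonStrict _≤_ using (_≤⁺_; [_])
open import Relation.Binary.Construct.Add.Supremum.Strict _<_ using (_<⁺_; [_]; [_]<⊤⁺)
open import Relation.Binary.Construct.Closure.ReflexiveTransitive using (Star; ε; _◅_)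
open import Relation.Binary.PropositionalEquality.Core
  using (_≡_; _≢_; refl; cong)
open import Relation.Nullary.Construct.Add.Supremum using (_⁺; [_]; ⊤⁺)
open import Relation.Nullary.Negation.Core using (¬_; contradiction)

record Digraph : Set₁ where
  field
    Vertex : Set
    Arc    : Vertex → Vertex → Set

module _ (G : Digraph) where
  open Digraph G

  HasOrder : ℕ → Set
  HasOrder k = Fin k ↔ Vertex

  -- An arc is an ordered pair of vertices: `Refinement` makes the proof of
  -- adjacency irrelevant, so that each pair is counted at most once.
  HasSize : ℕ → Set
  HasSize k = Fin k ↔ Refinement (Vertex × Vertex) (λ (u , v) → Arc u v)

  Walk : Vertex → Vertex → Set
  Walk = Star Arc

  walkLength : ∀ {u v} → Walk u v → ℕ
  walkLength ε       = zero
  walkLength (_ ◅ p) = suc (walkLength p)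

  walkVertices : ∀ {u v} → Walk u v → List Vertex
  walkVertices {u} ε       = u ∷ []
  walkVertices {u} (_ ◅ p) = u ∷ walkVertices p

  DirectedPath : Vertex → Vertex → Set
  DirectedPath u v = Σ (Walk u v) λ p → Unique (walkVertices p)

  pathLength : ∀ {u v} → DirectedPath u v → ℕ
  pathLength (p , _) = walkLength p

  -- `IsDistance u v d` says d(u,v) = d; the added top element ⊤⁺ plays ∞.
  data IsDistance (u v : Vertex) : ℕ ⁺ → Set where
    shortest    : (p : DirectedPath u v) →
                  (∀ (q : DirectedPath u v) → pathLength p ≤ pathLength q) →
                  IsDistance u v [ pathLength p ]
    unreachable : ¬ DirectedPath u v → IsDistance u v ⊤⁺

  -- A distance of the form [ a ] already provides a directed path, hence
  -- the path conditions of the first two cases are not repeated.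
  data IsSignedDistance (u v : Vertex) : ℤ ⁺ → Set where
    forward  : ∀ {a b} → IsDistance u v [ a ] → IsDistance v u b →
               [ a ] ≤⁺ b → IsSignedDistance u v [ + a ]
    backward : ∀ {a b} → IsDistance v u [ a ] → IsDistance u v b →
               [ a ] <⁺ b → IsSignedDistance u v [ - (+ a) ]
    neither  : ¬ DirectedPath u v → ¬ DirectedPath v u →
               IsSignedDistance u v ⊤⁺

  IsSignedDistanceFunction : (Vertex → Vertex → ℤ ⁺) → Set
  IsSignedDistanceFunction d± = ∀ u v → IsSignedDistance u v (d± u v)

  module _ (d± : Vertex → Vertex → ℤ ⁺) where

    distanceVector : ∀ {k} → Vec Vertex k → Vertex → Vec (ℤ ⁺) k
    distanceVector S v = map (λ u → d± u v) S

    -- Repetition-free vectors are the ordered sets of vertices.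
    IsResolvingSet : ∀ {k} → Vec Vertex k → Set
    IsResolvingSet S =
      Vec.Unique S ×
      (∀ v w → v ≢ w → distanceVector S v ≢ distanceVector S w)

  -- Distances need not be computable in an arbitrary digraph, so the signed
  -- distance function is asserted to exist; by `signedDistance-unique` there
  -- is pointwise at most one.
  HasMetricDimension : ℕ → Set
  HasMetricDimension k =
    ∃ λ d± → IsSignedDistanceFunction d± ×
             (∃ λ (S : Vec Vertex k) → IsResolvingSet d± S) ×
             (∀ {j} (S : Vec Vertex j) → IsResolvingSet d± S → k ≤ j)

  distance-unique : ∀ {u v d e} → IsDistance u v d → IsDistance u v e → d ≡ e
  distance-unique (shortest p p≤)  (shortest q q≤)  = cong [_] (≤-antisym (p≤ q) (q≤ p))
  distance-unique (shortest p _)   (unreachable ¬p) = contradiction p ¬p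
  distance-unique (unreachable ¬p) (shortest p _)   = contradiction p ¬p
  distance-unique (unreachable _)  (unreachable _)  = refl

  private
    distance⇒path : ∀ {u v a} → IsDistance u v [ a ] → DirectedPath u v
    distance⇒path (shortest p _) = p

    ≤⁺-<⁺-absurd : ∀ {x y} → x ≤⁺ y → ¬ (y <⁺ x)
    ≤⁺-<⁺-absurd [ a≤b ] [ b<a ] = <-irrefl refl (<-≤-trans b<a a≤b)

  signedDistance-unique : ∀ {u v x y} →
    IsSignedDistance u v x → IsSignedDistance u v y → x ≡ y
  signedDistance-unique (forward p _ _) (forward q _ _)
    with refl ← distance-unique p q = refl
  signedDistance-unique (forward p q le) (backward q′ p′ lt)
    with refl ← distance-unique p p′ | refl ← distance-unique q q′ =
    contradiction lt (≤⁺-<⁺-absurd le)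
  signedDistance-unique (forward p _ _) (neither ¬p _) =
    contradiction (distance⇒path p) ¬p
  signedDistance-unique (backward q p lt) (forward p′ q′ le)
    with refl ← distance-unique p p′ | refl ← distance-unique q q′ =
    contradiction lt (≤⁺-<⁺-absurd le)
  signedDistance-unique (backward p _ _) (backward q _ _)
    with refl ← distance-unique p q = refl
  signedDistance-unique (backward p _ _) (neither _ ¬p) =
    contradiction (distance⇒path p) ¬p
  signedDistance-unique (neither ¬p _) (forward p _ _) =
    contradiction (distance⇒path p) ¬p
  signedDistance-unique (neither _ ¬p) (backward p _ _) =
    contradiction (distance⇒path p) ¬p
  signedDistance-unique (neither _ _) (neither _ _) = refl

record Ruleset : Set₁ where
  infix 4 _⟶_
  field
    Position : Set
    _⟶_      : Position → Position → Set

-- Reachability is irrelevant in a vertex, so that a position reachable by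
-- several sequences of moves still gives a single vertex.
gameGraph : (R : Ruleset) → Ruleset.Position R → Digraph
gameGraph R start = record
  { Vertex = Refinement Position (Star _⟶_ start)
  ; Arc    = λ p q → value p ⟶ value q
  }
  where open Ruleset R

-- The position *k is represented by k.
nim : Ruleset
nim = record
  { Position = ℕ
  ; _⟶_      = _>_
  }

{-# OPTIONS --safe #-}
-- In G(nim, *n) there is an arc from every position to every smaller one, so
-- d±(u,v) is the sign of u − v.  Hence u distinguishes v < w exactly when
-- v ≤ u ≤ w, and a set resolves the graph iff it meets every pair {v, v+1},
-- i.e. iff it is a vertex cover of the path 0 − 1 − … − n.  The odd positions
-- form such a cover, and the pairs {2i, 2i+1} are a matching of size ⌈n/2⌉.
module Submission where

open import Defs
open import Data.Empty using (⊥-elim-irr)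
open import Data.Fin using (Fin; toℕ; fromℕ<)
open import Data.Fin.Properties
  using (toℕ<n; toℕ-injective; toℕ-fromℕ<; fromℕ<-toℕ; +↔⊎; any?; injective⇒≤)
open import Data.Integer.Base using (ℤ; +_; -_)
open import Data.Irrelevant using ([_])
open import Data.List.Relation.Unary.All using ([]; _∷_)
open import Data.List.Relation.Unary.AllPairs using ([]; _∷_)
open import Data.Nat
  using (ℕ; zero; suc; _+_; _≤_; _<_; _>_; z≤n; s≤s; ⌊_/2⌋; ⌈_/2⌉; _≟_; _≤?_)
open import Data.Nat.Combinatorics using (_C_; nC1≡n; nCk+nC[k+1]≡[n+1]C[k+1])
open import Data.Nat.Properties
open import Data.Product using (_×_; _,_; ∃; proj₁; proj₂)
open import Data.Refinement using (Refinement; value; _,_)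
open import Data.Refinement.Properties using (value-injective)
open import Data.Sum using (_⊎_; inj₁; inj₂)
open import Data.Sum.Function.Propositional using (_⊎-↔_)
open import Data.Vec using (Vec; lookup; tabulate)
open import Data.Vec.Properties
  using (lookup-map; lookup∘tabulate; tabulate-cong; tabulate∘lookup)
open import Data.Vec.Relation.Unary.Unique.Propositional.Properties using (tabulate⁺)
open import Function using (_∘_)
open import Function.Bundles using (_↔_; mk↔ₛ′)
open import Function.Properties.Inverse using (↔-refl; ↔-sym; ↔-trans)
open import Relation.Binary.Construct.Add.Supremum.NonStrict _≤_ using ([_]; _≤⊤⁺)
open import Relation.Binary.Construct.Add.Supremum.Strict _<_ using ([_]<⊤⁺)
open import Relation.Binary.Construct.Closure.ReflexiveTransitive using (Star; ε; _◅_; fold)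
open import Relation.Binary.Definitions using (tri<; tri≈; tri>)
open import Relation.Binary.PropositionalEquality
open import Relation.Nullary using (yes; no; contradiction)
open import Relation.Nullary.Construct.Add.Supremum using (_⁺; [_]; ⊤⁺)
open import Relation.Nullary.Decidable using (recompute)

-- Reachability in single-heap Nim

reachable⇒≤ : ∀ {m k} → Star _>_ m k → k ≤ m
reachable⇒≤ = fold (λ m k → k ≤ m) (λ m>l k≤l → ≤-trans k≤l (<⇒≤ m>l)) ≤-refl

≤⇒reachable : ∀ {m k} → k ≤ m → Star _>_ m k
≤⇒reachable k≤m with m≤n⇒m<n∨m≡n k≤m
... | inj₁ k<m  = k<m ◅ ε
... | inj₂ refl = ε

-- Counting the arcs by binomial coefficients

Pair : ℕ → Set
Pair m = Refinement (ℕ × ℕ) (λ (u , v) → v < u × u < m)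

-- Split on whether the larger entry `u` equals `m`: if so, only `v < m` remains to be chosen; if
-- not, `u < m`. This is the combinatorial form of Pascal's rule used in the count below.
Pair-suc : ∀ m → Pair (suc m) ↔ (Fin m ⊎ Pair m)
Pair-suc m = mk↔ₛ′ to from to∘from from∘to
  where
  to : Pair (suc m) → Fin m ⊎ Pair m
  to ((u , v) , [ p ]) with u ≟ m
  ... | yes u≡m = inj₁ (fromℕ< (subst (v <_) u≡m (proj₁ p)))
  ... | no  u≢m = inj₂ ((u , v) , [ proj₁ p , ≤∧≢⇒< (m<1+n⇒m≤n (proj₂ p)) u≢m ])

  from : Fin m ⊎ Pair m → Pair (suc m)
  from (inj₁ i)               = (m , toℕ i) , [ toℕ<n i , n<1+n m ]
  from (inj₂ ((u , v) , [ p ])) = (u , v) , [ proj₁ p , m<n⇒m<1+n (proj₂ p) ]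

  to∘from : ∀ x → to (from x) ≡ x
  to∘from (inj₁ i) with m ≟ m
  ... | yes _   = cong inj₁ (fromℕ<-toℕ i _)
  ... | no  m≢m = contradiction refl m≢m
  to∘from (inj₂ ((u , v) , [ p ])) with u ≟ m
  ... | yes u≡m = ⊥-elim-irr (<-irrefl u≡m (proj₂ p))
  ... | no  _   = refl

  from∘to : ∀ x → from (to x) ≡ x
  from∘to ((u , v) , [ p ]) with u ≟ m
  ... | yes u≡m = value-injective (cong₂ _,_ (sym u≡m) (toℕ-fromℕ< _))
  ... | no  _   = refl

Fin-C2↔Pair : ∀ m → Fin (m C 2) ↔ Pair m
Fin-C2↔Pair zero    = mk↔ₛ′ (λ ()) (λ { ((u , _) , [ p ]) → ⊥-elim-irr (n≮0 (proj₂ p)) })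
                            (λ { ((u , _) , [ p ]) → ⊥-elim-irr (n≮0 (proj₂ p)) }) (λ ())
Fin-C2↔Pair (suc m) =
  subst (λ k → Fin k ↔ Pair (suc m))
        -- Reading the summand `m` as `m C 1` turns `m + m C 2` into an instance of Pascal's rule.
        (trans (cong (_+ m C 2) (sym (nC1≡n m))) (nCk+nC[k+1]≡[n+1]C[k+1] m 1))
        (↔-trans +↔⊎ (↔-trans (↔-refl ⊎-↔ Fin-C2↔Pair m) (↔-sym (Pair-suc m))))

-- The signed distance on natural numbers

nimDistance : ℕ → ℕ → ℤ ⁺
nimDistance u v with <-cmp u v
... | tri< _ _ _ = [ - (+ 1) ]
... | tri≈ _ _ _ = [ + 0 ]
... | tri> _ _ _ = [ + 1 ]

nimDistance-< : ∀ {u v} → u < v → nimDistance u v ≡ [ - (+ 1) ]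
nimDistance-< {u} {v} u<v with <-cmp u v
... | tri< _ _ _   = refl
... | tri≈ u≮v _ _ = contradiction u<v u≮v
... | tri> u≮v _ _ = contradiction u<v u≮v

nimDistance-> : ∀ {u v} → v < u → nimDistance u v ≡ [ + 1 ]
nimDistance-> {u} {v} v<u with <-cmp u v
... | tri< _ _ v≮u = contradiction v<u v≮u
... | tri≈ _ _ v≮u = contradiction v<u v≮u
... | tri> _ _ _   = refl

-- From `v ≤ u` the first value is 0 or 1, from `u ≤ w` the second is 0 or -1; they can agree only
-- at 0, where `u` equals both.
nimDistance-separates : ∀ {u v w} → v ≤ u → u ≤ w →
                        nimDistance u v ≡ nimDistance u w → v ≡ w
nimDistance-separates {u} {v} {w} v≤u u≤w eq with <-cmp u v | <-cmp u w
... | tri< u<v _ _ | _            = contradiction v≤u (<⇒≱ u<v)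
... | _            | tri> _ _ w<u = contradiction u≤w (<⇒≱ w<u)
... | tri≈ _ u≡v _ | tri≈ _ u≡w _ = trans (sym u≡v) u≡w
nimDistance-separates _ _ () | tri≈ _ _ _ | tri< _ _ _
nimDistance-separates _ _ () | tri> _ _ _ | tri< _ _ _
nimDistance-separates _ _ () | tri> _ _ _ | tri≈ _ _ _

-- Halving, and the blocks {2i, 2i+1}

2⌊n/2⌋≤n : ∀ n → ⌊ n /2⌋ + ⌊ n /2⌋ ≤ n
2⌊n/2⌋≤n n = subst (⌊ n /2⌋ + ⌊ n /2⌋ ≤_) (⌊n/2⌋+⌈n/2⌉≡n n)
                   (+-monoʳ-≤ ⌊ n /2⌋ (⌊n/2⌋≤⌈n/2⌉ n))

n≤1+2⌊n/2⌋ : ∀ n → n ≤ suc (⌊ n /2⌋ + ⌊ n /2⌋)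
n≤1+2⌊n/2⌋ zero          = z≤n
n≤1+2⌊n/2⌋ (suc zero)    = s≤s z≤n
n≤1+2⌊n/2⌋ (suc (suc n)) =
  s≤s (s≤s (subst (n ≤_) (sym (+-suc _ _)) (n≤1+2⌊n/2⌋ n)))

m<n⇒2+2m≤2n : ∀ {m n} → m < n → suc (suc (m + m)) ≤ n + n
m<n⇒2+2m≤2n {m} {n} m<n =
  subst (_≤ n + n) (cong suc (+-suc m m)) (+-mono-≤ m<n m<n)

-- Since `⌈ n /2⌉` unfolds to `⌊ suc n /2⌋`, doubling gives 2m + 2 ≤ n + 1. Thus the whole block
-- {2m, 2m+1} lies in the graph.
m<⌈n/2⌉⇒1+2m≤n : ∀ {m n} → m < ⌈ n /2⌉ → suc (m + m) ≤ n
m<⌈n/2⌉⇒1+2m≤n {n = n} m<⌈n/2⌉ =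
  m<1+n⇒m≤n (≤-trans (m<n⇒2+2m≤2n m<⌈n/2⌉) (2⌊n/2⌋≤n (suc n)))

-- The half of `u` names the block containing `u`. A position outside the block {2i, 2i+1} is below
-- both members or above both, so it sees the same sign.
nimDistance-const : ∀ {u i} → ⌊ u /2⌋ ≢ i →
                    nimDistance u (i + i) ≡ nimDistance u (suc (i + i))
nimDistance-const {u} {i} h≢i with <-cmp ⌊ u /2⌋ i
... | tri≈ _ h≡i _ = contradiction h≡i h≢i
... | tri< h<i _ _ = trans (nimDistance-< u<2i) (sym (nimDistance-< (m<n⇒m<1+n u<2i)))
  where
  u<2i : u < i + i
  u<2i = ≤-trans (s≤s (n≤1+2⌊n/2⌋ u)) (m<n⇒2+2m≤2n h<i)
... | tri> _ _ i<h = trans (nimDistance-> (<-trans (n<1+n _) 1+2i<u)) (sym (nimDistance-> 1+2i<u))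
  where
  1+2i<u : suc (i + i) < u
  1+2i<u = ≤-trans (m<n⇒2+2m≤2n i<h) (2⌊n/2⌋≤n u)

lookup-ext : ∀ {A : Set} {m} {xs ys : Vec A m} →
             (∀ k → lookup xs k ≡ lookup ys k) → xs ≡ ys
lookup-ext {xs = xs} {ys} eq =
  trans (sym (tabulate∘lookup xs)) (trans (tabulate-cong eq) (tabulate∘lookup ys))

-- Order and size of the game graph

module _ (n : ℕ) where

  private
    G : Digraph
    G = gameGraph nim n

  open Digraph G

  vertex : (k : ℕ) → k ≤ n → Vertex
  vertex k k≤n = k , [ ≤⇒reachable k≤n ]

  value≤n : (v : Vertex) → value v ≤ n
  -- The reachability proof is irrelevant; decidability of `≤` recovers a usable bound from it.
  value≤n (v , [ p ]) = recompute (v ≤? n) (reachable⇒≤ p)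

  order : HasOrder G (suc n)
  order = mk↔ₛ′ (λ i → vertex (toℕ i) (m<1+n⇒m≤n (toℕ<n i)))
                (λ v → fromℕ< (s≤s (value≤n v)))
                (λ v → value-injective (toℕ-fromℕ< _))
                (λ i → fromℕ<-toℕ i _)

  size : HasSize G (suc n C 2)
  -- The bounds and the reachability proofs are rebuilt from each other; being irrelevant, they let
  -- both round trips hold by `refl`.
  size = ↔-trans (Fin-C2↔Pair (suc n)) (mk↔ₛ′ to from (λ _ → refl) (λ _ → refl))
    where
    to : Pair (suc n) → Refinement (Vertex × Vertex) (λ (u , v) → Arc u v)
    to ((u , v) , [ p ]) =
      ( (u , [ ≤⇒reachable (m<1+n⇒m≤n (proj₂ p)) ])
      , (v , [ ≤⇒reachable (m<1+n⇒m≤n (<-trans (proj₁ p) (proj₂ p))) ])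
      ) , [ proj₁ p ]

    from : Refinement (Vertex × Vertex) (λ (u , v) → Arc u v) → Pair (suc n)
    from ((u , v) , [ a ]) = (value u , value v) , [ a , s≤s (value≤n u) ]

  -- Distances in the game graph

  walk⇒≥ : ∀ {u v} → Walk G u v → value v ≤ value u
  walk⇒≥ ε       = ≤-refl
  walk⇒≥ (a ◅ p) = ≤-trans (walk⇒≥ p) (<⇒≤ a)

  distance-refl : ∀ {u} → IsDistance G u u [ 0 ]
  distance-refl = shortest (ε , [] ∷ []) (λ _ → z≤n)

  -- A single arc already leads to `v`; only the empty walk is shorter, and it would force `u` and
  -- `v` to coincide.
  distance-> : ∀ {u v} → value v < value u → IsDistance G u v [ 1 ]
  distance-> {u} {v} v<u =
    shortest (v<u ◅ ε , ((λ u≡v → <-irrefl (cong value (sym u≡v)) v<u) ∷ []) ∷ [] ∷ [])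
             (λ { (ε , _) → contradiction v<u (<-irrefl refl) ; (_ ◅ _ , _) → s≤s z≤n })

  distance-< : ∀ {u v} → value u < value v → IsDistance G u v ⊤⁺
  distance-< u<v = unreachable (λ (p , _) → <⇒≱ u<v (walk⇒≥ p))

  d± : Vertex → Vertex → ℤ ⁺
  d± u v = nimDistance (value u) (value v)

  d±-isSignedDistance : IsSignedDistanceFunction G d±
  d±-isSignedDistance u v with <-cmp (value u) (value v)
  ... | tri< u<v _ _ = backward (distance-> u<v) (distance-< u<v) [ 1 ]<⊤⁺
  ... | tri> _ _ v<u = forward (distance-> v<u) (distance-< v<u) (_ ≤⊤⁺)
  ... | tri≈ _ u≡v _ with refl ← value-injective {v = u} {w = v} u≡v =
    forward distance-refl distance-refl [ z≤n ]

  -- Upper bound: the odd positions resolve the graph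

  oddVertex : Fin ⌈ n /2⌉ → Vertex
  oddVertex i = vertex (suc (toℕ i + toℕ i)) (m<⌈n/2⌉⇒1+2m≤n (toℕ<n i))

  oddVertex-injective : ∀ {i j} → oddVertex i ≡ oddVertex j → i ≡ j
  oddVertex-injective {i} {j} eq = toℕ-injective (begin
    toℕ i                    ≡⟨ n≡⌈n+n/2⌉ (toℕ i) ⟩
    -- The ceiling of 2i/2 unfolds to the floor of (2i+1)/2, so halving the position recovers the
    -- index.
    ⌈ toℕ i + toℕ i /2⌉      ≡⟨ cong (⌊_/2⌋ ∘ value) eq ⟩
    ⌈ toℕ j + toℕ j /2⌉      ≡⟨ n≡⌈n+n/2⌉ (toℕ j) ⟨
    toℕ j                    ∎)
    where open ≡-Reasoning

  oddVertices : Vec Vertex ⌈ n /2⌉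
  oddVertices = tabulate oddVertex

  -- The odd number 2⌊v/2⌋ + 1 is v or v + 1, so it lies between v and w.
  oddVertices-separate : ∀ v w → value v < value w →
    distanceVector G d± oddVertices v ≢ distanceVector G d± oddVertices w
  oddVertices-separate v w v<w eq =
    <-irrefl (nimDistance-separates v≤u u≤w entries-agree) v<w
    where
    h = ⌊ value v /2⌋

    h<⌈n/2⌉ : h < ⌈ n /2⌉
    -- From v < w ≤ n follows v + 2 ≤ n + 1, and halving both sides gives h + 1 ≤ `⌈ n /2⌉`.
    h<⌈n/2⌉ = ⌊n/2⌋-mono (s≤s (≤-trans v<w (value≤n w)))

    i : Fin ⌈ n /2⌉
    i = fromℕ< h<⌈n/2⌉

    entry : ∀ x → lookup (distanceVector G d± oddVertices x) i ≡
                  nimDistance (suc (h + h)) (value x)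
    entry x = begin
      lookup (distanceVector G d± oddVertices x) i
        ≡⟨ lookup-map i (λ u → d± u x) oddVertices ⟩
      d± (lookup oddVertices i) x
        ≡⟨ cong (λ u → d± u x) (lookup∘tabulate oddVertex i) ⟩
      nimDistance (suc (toℕ i + toℕ i)) (value x)
        ≡⟨ cong (λ k → nimDistance (suc (k + k)) (value x)) (toℕ-fromℕ< h<⌈n/2⌉) ⟩
      nimDistance (suc (h + h)) (value x) ∎
      where open ≡-Reasoning

    entries-agree : nimDistance (suc (h + h)) (value v) ≡
                    nimDistance (suc (h + h)) (value w)
    entries-agree =
      trans (sym (entry v)) (trans (cong (λ xs → lookup xs i) eq) (entry w))

    v≤u : value v ≤ suc (h + h)
    v≤u = n≤1+2⌊n/2⌋ (value v)

    u≤w : suc (h + h) ≤ value w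
    u≤w = ≤-trans (s≤s (2⌊n/2⌋≤n (value v))) v<w

  oddVertices-resolving : IsResolvingSet G d± oddVertices
  oddVertices-resolving = tabulate⁺ oddVertex-injective , separate
    where
    separate : ∀ v w → v ≢ w →
      distanceVector G d± oddVertices v ≢ distanceVector G d± oddVertices w
    separate v w v≢w with <-cmp (value v) (value w)
    ... | tri< v<w _ _ = oddVertices-separate v w v<w
    ... | tri≈ _ v≡w _ = contradiction (value-injective v≡w) v≢w
    ... | tri> _ _ w<v = oddVertices-separate w v w<v ∘ sym

  -- Lower bound: one element of the resolving set per block

  -- If `S` missed the block {2i, 2i+1}, every entry would agree on its two members, whose distance
  -- vectors would then coincide.
  resolving-meets : ∀ {j} (S : Vec Vertex j) → IsResolvingSet G d± S →
                    ∀ {i} → i < ⌈ n /2⌉ → ∃ λ k → ⌊ value (lookup S k) /2⌋ ≡ i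
  resolving-meets S (_ , separate) {i} i<⌈n/2⌉ with any? (λ k → ⌊ value (lookup S k) /2⌋ ≟ i)
  ... | yes found = found
  ... | no ¬found = contradiction (lookup-ext entry) (separate v w (1+n≢n ∘ sym ∘ cong value))
    where
    1+2i≤n = m<⌈n/2⌉⇒1+2m≤n i<⌈n/2⌉
    v = vertex (i + i) (<⇒≤ 1+2i≤n)
    w = vertex (suc (i + i)) 1+2i≤n

    entry : ∀ k → lookup (distanceVector G d± S v) k ≡
                  lookup (distanceVector G d± S w) k
    entry k = trans (lookup-map k _ S)
                    (trans (nimDistance-const (λ eq → ¬found (k , eq))) (sym (lookup-map k _ S)))

  -- Pigeonhole: choosing for each block an index of `S` that meets it is injective, because the
  -- element at that index determines its block by halving.
  resolving⇒≥ : ∀ {j} (S : Vec Vertex j) → IsResolvingSet G d± S → ⌈ n /2⌉ ≤ j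
  resolving⇒≥ S resolving = injective⇒≤ {f = proj₁ ∘ meets} (λ {i} {i′} eq → toℕ-injective
    (trans (sym (proj₂ (meets i)))
           (trans (cong (λ k → ⌊ value (lookup S k) /2⌋) eq) (proj₂ (meets i′)))))
    where
    meets : (i : Fin ⌈ n /2⌉) → ∃ λ k → ⌊ value (lookup S k) /2⌋ ≡ toℕ i
    meets i = resolving-meets S resolving (toℕ<n i)

  metricDimension : HasMetricDimension G ⌈ n /2⌉
  metricDimension =
    d± , d±-isSignedDistance , (oddVertices , oddVertices-resolving) , resolving⇒≥

theorem3p1 : ∀ (n : ℕ) → 1 ≤ n →
    HasOrder (gameGraph nim n) (n + 1) ×
    HasSize (gameGraph nim n) ((n + 1) C 2) ×
    HasMetricDimension (gameGraph nim n) ⌈ n /2⌉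
theorem3p1 n _ =
  subst (HasOrder (gameGraph nim n)) 1+n≡n+1 (order n) ,
  subst (λ k → HasSize (gameGraph nim n) (k C 2)) 1+n≡n+1 (size n) ,
  metricDimension n
  where
  1+n≡n+1 : suc n ≡ n + 1
  1+n≡n+1 = +-comm 1 n
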